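{- Let $\mathbf{r}=(r_0,r_1,r_2,\ldots)$ be the regular paperfolding sequence. For every positive integer $k$, the $t$-Hankel determinant $H_k(\mathbf{r},t)$ is a polynomial in $t$ of degree less than or equal to $3$.
   Context: The regular paperfolding sequence $\mathbf{r}$ is defined by the generating function $\sum_{n\ge0}r_nx^n=\sum_{n\ge0}\frac{x^{2^n-1}}{1-x^{2^{n+2}}}$, so $\mathbf{r}=(1,1,0,1,1,0,0,\ldots)$. For a sequence $\mathbf{c}=(c_0,c_1,\ldots)$, a parameter $t$ and $k\ge1$, the $t$-Hankel determinant is $H_k(\mathbf{c},t)=\det(a_{ij})_{0\le i,j\le k-1}$ where $a_{ij}=c_{i+j}$ for $i\ne j$ and $a_{ii}=c_{2i}\,t$ (i.e. the ordinary Hankel determinant with every diagonal entry multiplied by $t$). -}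

module Defs where

open import Algebra.Bundles using (RawRing)
import Algebra.Definitions.RawSemiring as RawSemiringDefs
open import Data.Bool.Base using (if_then_else_)
open import Data.Fin.Base using (Fin; zero; suc; toℕ)
import Data.Fin.Properties as Fin
open import Data.Integer.Base as ℤ using (ℤ; 0ℤ; 1ℤ)
import Data.Integer.Properties as ℤ
open import Data.List.Base using (List; []; _∷_; map)
open import Data.Nat.Base as ℕ using (ℕ; zero; suc; NonZero; _≤_; _<_; s≤s; s≤s⁻¹; z≤n)
open import Data.Nat.Divisibility using (_∣_; _∣?_; _∣0; >⇒∤; ∣-refl; ∣m∸n∣n⇒∣m; ∣m+n∣m⇒∣n)
import Data.Nat.Properties as ℕ
open import Data.Sum.Base using (inj₁; inj₂)
open import Data.Vec.Functional using (removeAt)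
open import Level using (0ℓ)
open import Relation.Binary.PropositionalEquality
open import Relation.Nullary using (¬_; Dec; does; yes; no)
open import Relation.Nullary.Decidable using (dec-true; dec-false)

-- f n is the coefficient of xⁿ.
Series : Set
Series = ℕ → ℤ

-- Multiplication by the monomial xᵃ.
x^_·_ : ℕ → Series → Series
(x^ zero  · f) n       = f n
(x^ suc a · f) zero    = 0ℤ
(x^ suc a · f) (suc n) = (x^ a · f) n

1ₛ : Series
1ₛ zero    = 1ℤ
1ₛ (suc _) = 0ℤ

-- 1 / (1 - xᵈ) for d > 0; see geometric-inverse.
1/[1-x^_] : ℕ → Series
1/[1-x^ d ] n = if does (d ∣? n) then 1ℤ else 0ℤ

partialSum : (ℕ → Series) → ℕ → Series
partialSum f zero    m = 0ℤ
partialSum f (suc N) m = partialSum f N m ℤ.+ f N m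

-- Σ_{n ≥ 0} f n, meaningful when xⁿ divides f n for every n: the partial sums
-- are then constant at xᵐ from N = m + 1 on; see ∑-limit.
∑ : (ℕ → Series) → Series
∑ f m = partialSum f (suc m) m

paperfoldingTerm : ℕ → Series
paperfoldingTerm n = x^ (2 ℕ.^ n ℕ.∸ 1) · 1/[1-x^ 2 ℕ.^ (n ℕ.+ 2) ]

paperfolding : ℕ → ℤ
paperfolding = ∑ paperfoldingTerm

shift-< : ∀ a f n → n < a → (x^ a · f) n ≡ 0ℤ
shift-< (suc a) f zero    _     = refl
shift-< (suc a) f (suc n) n<a   = shift-< a f n (s≤s⁻¹ n<a)

shift-≥ : ∀ a f n → a ≤ n → (x^ a · f) n ≡ f (n ℕ.∸ a)
shift-≥ zero    f n       _   = refl
shift-≥ (suc a) f (suc n) a≤n = shift-≥ a f n (s≤s⁻¹ a≤n)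

geometric-∣ : ∀ {d n} → d ∣ n → 1/[1-x^ d ] n ≡ 1ℤ
geometric-∣ {d} {n} d∣n = cong (λ b → if b then 1ℤ else 0ℤ) (dec-true (d ∣? n) d∣n)

geometric-∤ : ∀ {d n} → ¬ d ∣ n → 1/[1-x^ d ] n ≡ 0ℤ
geometric-∤ {d} {n} d∤n = cong (λ b → if b then 1ℤ else 0ℤ) (dec-false (d ∣? n) d∤n)

geometric-inverse : ∀ d .{{_ : NonZero d}} n →
                    1/[1-x^ d ] n ℤ.- (x^ d · 1/[1-x^ d ]) n ≡ 1ₛ n
geometric-inverse d@(suc _) zero = cong (ℤ._- 0ℤ) (geometric-∣ (d ∣0))
geometric-inverse d n@(suc _) with d ℕ.≤? n
... | no d≰n = cong₂ ℤ._-_ (geometric-∤ (>⇒∤ (ℕ.≰⇒> d≰n)))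
                           (shift-< d 1/[1-x^ d ] n (ℕ.≰⇒> d≰n))
... | yes d≤n = trans (cong (λ c → 1/[1-x^ d ] n ℤ.- c)
                            (trans (shift-≥ d 1/[1-x^ d ] n d≤n) (compare (d ∣? n))))
                      (ℤ.+-inverseʳ (1/[1-x^ d ] n))
  where
  compare : Dec (d ∣ n) → 1/[1-x^ d ] (n ℕ.∸ d) ≡ 1/[1-x^ d ] n
  compare (yes d∣n) = trans
    (geometric-∣ (∣m+n∣m⇒∣n (subst (d ∣_) (sym (ℕ.m+[n∸m]≡n d≤n)) d∣n) ∣-refl))
    (sym (geometric-∣ d∣n))
  compare (no d∤n)  = trans
    (geometric-∤ (λ d∣n∸d → d∤n (∣m∸n∣n⇒∣m d d≤n d∣n∸d ∣-refl)))
    (sym (geometric-∤ d∤n))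

∑-limit : ∀ f → (∀ n m → m < n → f n m ≡ 0ℤ) →
          ∀ m N → m < N → partialSum f N m ≡ ∑ f m
∑-limit f f-order m (suc N) m<1+N with ℕ.m≤n⇒m<n∨m≡n (s≤s⁻¹ m<1+N)
... | inj₂ refl = refl
... | inj₁ m<N  = trans (cong₂ ℤ._+_ (∑-limit f f-order m N m<N) (f-order N m m<N))
                        (ℤ.+-identityʳ (∑ f m))

paperfoldingTerm-order : ∀ n m → m < n → paperfoldingTerm n m ≡ 0ℤ
paperfoldingTerm-order n m m<n =
  shift-< (2 ℕ.^ n ℕ.∸ 1) 1/[1-x^ 2 ℕ.^ (n ℕ.+ 2) ] m (ℕ.<-≤-trans m<n n≤2ⁿ∸1)
  where
  1+k≤2^k : ∀ k → suc k ≤ 2 ℕ.^ k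
  1+k≤2^k zero    = s≤s z≤n
  1+k≤2^k (suc k) = ℕ.+-mono-≤ (ℕ.m^n>0 2 k) (ℕ.≤-trans (1+k≤2^k k) (ℕ.m≤m+n _ 0))

  n≤2ⁿ∸1 : n ≤ 2 ℕ.^ n ℕ.∸ 1
  n≤2ⁿ∸1 = ℕ.∸-monoˡ-≤ 1 (1+k≤2^k n)

paperfolding-start : map paperfolding (0 ∷ 1 ∷ 2 ∷ 3 ∷ 4 ∷ 5 ∷ 6 ∷ [])
                   ≡ 1ℤ ∷ 1ℤ ∷ 0ℤ ∷ 1ℤ ∷ 1ℤ ∷ 0ℤ ∷ 0ℤ ∷ []
paperfolding-start = refl

-- Coefficient lists, constant term first. Trailing zeros are allowed, so
-- equality of polynomials is _≈ₚ_ rather than _≡_.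
Poly : Set
Poly = List ℤ

coeff : Poly → ℕ → ℤ
coeff []      _       = 0ℤ
coeff (a ∷ p) zero    = a
coeff (a ∷ p) (suc n) = coeff p n

infix  4 _≈ₚ_
infixl 6 _+ₚ_
infixl 7 _*ₚ_

_≈ₚ_ : Poly → Poly → Set
p ≈ₚ q = ∀ n → coeff p n ≡ coeff q n

_+ₚ_ : Poly → Poly → Poly
[]      +ₚ q       = q
(a ∷ p) +ₚ []      = a ∷ p
(a ∷ p) +ₚ (b ∷ q) = (a ℤ.+ b) ∷ (p +ₚ q)

-ₚ_ : Poly → Poly
-ₚ_ = map (λ a → ℤ.- a)

_*ₚ_ : Poly → Poly → Poly
[]      *ₚ q = []
(a ∷ p) *ₚ q = map (a ℤ.*_) q +ₚ (0ℤ ∷ (p *ₚ q))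

const : ℤ → Poly
const a = a ∷ []

t : Poly
t = 0ℤ ∷ 1ℤ ∷ []

ℤ[t] : RawRing 0ℓ 0ℓ
ℤ[t] = record
  { Carrier = Poly
  ; _≈_     = _≈ₚ_
  ; _+_     = _+ₚ_
  ; _*_     = _*ₚ_
  ; -_      = -ₚ_
  ; 0#      = []
  ; 1#      = const 1ℤ
  }

Degree≤ : ℕ → Poly → Set
Degree≤ d p = ∀ n → d < n → coeff p n ≡ 0ℤ

module Determinant {c ℓ} (R : RawRing c ℓ) where
  open RawRing R
  open RawSemiringDefs rawSemiring using (sum; _^_)

  SquareMatrix : ℕ → Set c
  SquareMatrix n = Fin n → Fin n → Carrier

  det : ∀ {n} → SquareMatrix n → Carrier
  det {zero}  A = 1#
  det {suc n} A =
    sum λ j → (- 1#) ^ toℕ j * (A zero j * det (λ i → removeAt (A (suc i)) j))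

open Determinant ℤ[t] public using (SquareMatrix; det)

tHankelMatrix : (ℕ → ℤ) → ∀ k → SquareMatrix k
tHankelMatrix c k i j =
  if does (i Fin.≟ j) then const (c (2 ℕ.* toℕ i)) *ₚ t
                      else const (c (toℕ i ℕ.+ toℕ j))

tHankel : ℕ → (ℕ → ℤ) → Poly
tHankel k c = det (tHankelMatrix c k)

-- For even m, r_m is 1 if 4 ∣ m and 0 otherwise. Hence t survives only on the
-- diagonal entries of even index, and for odd i the difference of rows i + 4
-- and i is free of t and vanishes in every odd column. Row operations thus
-- replace each odd row i ≥ 5 by one that, in the Leibniz expansion, must use up
-- an even column without contributing a factor t. Of the ⌈k/2⌉ even columns at
-- most ⌈k/2⌉ - (⌊k/2⌋ - 2) ≤ 3 are then left to contribute one.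
module Submission where

open import Defs
open import Algebra.Bundles using (module RawRing)
import Algebra.Definitions.RawSemiring as RawSemiringDefs
open import Data.Fin.Base using (Fin; zero; suc; toℕ; punchIn)
import Data.Fin.Properties as Fin
open import Data.Integer.Base as ℤ using (ℤ; -[1+_]; 0ℤ; 1ℤ; -1ℤ; _+_; _*_; _-_; _^_)
import Data.Integer.Properties as ℤ
open import Data.Integer.Tactic.RingSolver using (solve-∀)
open import Data.List.Base using (List; []; _∷_; map; tabulate)
open import Data.Nat.Base as ℕ using (ℕ; zero; suc; NonZero; _≤_; _<_; z≤n; s≤s; s≤s⁻¹; ⌊_/2⌋; ⌈_/2⌉)
open import Data.Nat.Divisibility
import Data.Nat.Properties as ℕ
open import Data.Nat.Tactic.RingSolver using () renaming (solve-∀ to ℕ-solve-∀)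
open import Data.Sum.Base using (inj₁; inj₂)
open import Function.Base using (_∘_)
open import Relation.Binary.PropositionalEquality
open import Relation.Nullary using (¬_; Dec; yes; no; contradiction)

open RawSemiringDefs (RawRing.rawSemiring ℤ[t]) using (sum) renaming (_^_ to _^ₚ_)

-- Cauchy product of coefficient sequences

infixl 7 _⊛_

_⊛_ : Series → Series → Series
(p ⊛ s) zero    = p 0 * s 0
(p ⊛ s) (suc n) = p 0 * s (suc n) + ((p ∘ suc) ⊛ s) n

⊛-cong : ∀ {p q s u : Series} → p ≗ q → s ≗ u → p ⊛ s ≗ q ⊛ u
⊛-cong p≗q s≗u zero    = cong₂ _*_ (p≗q 0) (s≗u 0)
⊛-cong p≗q s≗u (suc n) =
  cong₂ _+_ (cong₂ _*_ (p≗q 0) (s≗u (suc n))) (⊛-cong (p≗q ∘ suc) s≗u n)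

⊛-congʳ : ∀ p {s u : Series} → s ≗ u → p ⊛ s ≗ p ⊛ u
⊛-congʳ p = ⊛-cong {p} (λ _ → refl)

-- The decomposition of `p` as `p 0` plus x times `p ∘ suc`; one equation for both clauses of the
-- product.
⊛-unfold : ∀ p s n → (p ⊛ s) n ≡ p 0 * s n + (x^ 1 · (p ∘ suc ⊛ s)) n
⊛-unfold p s zero    = sym (ℤ.+-identityʳ _)
⊛-unfold p s (suc n) = refl

⊛-linearʳ : ∀ p a s u n → (p ⊛ (λ m → a * s m + u m)) n ≡ a * (p ⊛ s) n + (p ⊛ u) n
⊛-linearʳ p a s u zero    = lemma (p 0) a (s 0) (u 0)
  where
  lemma : ∀ x a y z → x * (a * y + z) ≡ a * (x * y) + x * z
  lemma = solve-∀
⊛-linearʳ p a s u (suc n) =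
  trans (cong (p 0 * (a * s (suc n) + u (suc n)) +_) (⊛-linearʳ (p ∘ suc) a s u n))
        (lemma (p 0) a (s (suc n)) (u (suc n)) _ _)
  where
  lemma : ∀ x a y z v w → x * (a * y + z) + (a * v + w) ≡ a * (x * y + v) + (x * z + w)
  lemma = solve-∀

⊛-distribˡ-minus : ∀ p s u n → (p ⊛ (λ m → s m - u m)) n ≡ (p ⊛ s) n - (p ⊛ u) n
⊛-distribˡ-minus p s u zero    = lemma (p 0) (s 0) (u 0)
  where
  lemma : ∀ x y z → x * (y - z) ≡ x * y - x * z
  lemma = solve-∀
⊛-distribˡ-minus p s u (suc n) =
  trans (cong (p 0 * (s (suc n) - u (suc n)) +_) (⊛-distribˡ-minus (p ∘ suc) s u n))
        (lemma (p 0) (s (suc n)) (u (suc n)) _ _)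
  where
  lemma : ∀ x y z v w → x * (y - z) + (v - w) ≡ x * y + v - (x * z + w)
  lemma = solve-∀

⊛-distribʳ-minus : ∀ p q s n → ((λ m → p m - q m) ⊛ s) n ≡ (p ⊛ s) n - (q ⊛ s) n
⊛-distribʳ-minus p q s zero    = lemma (p 0) (q 0) (s 0)
  where
  lemma : ∀ x y z → (x - y) * z ≡ x * z - y * z
  lemma = solve-∀
⊛-distribʳ-minus p q s (suc n) =
  trans (cong ((p 0 - q 0) * s (suc n) +_) (⊛-distribʳ-minus (p ∘ suc) (q ∘ suc) s n))
        (lemma (p 0) (q 0) (s (suc n)) _ _)
  where
  lemma : ∀ x y z v w → (x - y) * z + (v - w) ≡ x * z + v - (y * z + w)
  lemma = solve-∀

⊛-zeroʳ : ∀ p n → (p ⊛ (λ _ → 0ℤ)) n ≡ 0ℤ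
⊛-zeroʳ p zero    = ℤ.*-zeroʳ (p 0)
⊛-zeroʳ p (suc n) = cong₂ _+_ (ℤ.*-zeroʳ (p 0)) (⊛-zeroʳ (p ∘ suc) n)

⊛-constant : ∀ p s → (∀ n → p (suc n) ≡ 0ℤ) → ∀ n → (p ⊛ s) n ≡ p 0 * s n
⊛-constant p s p≈0 zero    = refl
⊛-constant p s p≈0 (suc n) = trans (cong (p 0 * s (suc n) +_) (rest n)) (ℤ.+-identityʳ _)
  where
  rest : ∀ n → ((p ∘ suc) ⊛ s) n ≡ 0ℤ
  rest n = trans (⊛-constant (p ∘ suc) s (p≈0 ∘ suc) n) (trans (cong (_* s n) (p≈0 0)) (ℤ.*-zeroˡ (s n)))

⊛-x^1 : ∀ p s → p ⊛ (x^ 1 · s) ≗ x^ 1 · (p ⊛ s)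
⊛-x^1 p s zero    = ℤ.*-zeroʳ (p 0)
⊛-x^1 p s (suc n) =
  trans (cong (p 0 * s n +_) (⊛-x^1 (p ∘ suc) s n)) (sym (⊛-unfold p s n))

-- Peeling coefficients off `p` alone suffices, since multiplication by `q` is linear and commutes
-- with x. This is the commutativity of entries behind the anticommutativity of row expansions.
⊛-leftComm : ∀ p q s n → (p ⊛ (q ⊛ s)) n ≡ (q ⊛ (p ⊛ s)) n
⊛-leftComm p q s n = begin
  (p ⊛ (q ⊛ s)) n                                            ≡⟨ ⊛-unfold p (q ⊛ s) n ⟩
  p 0 * (q ⊛ s) n + (x^ 1 · (p ∘ suc ⊛ (q ⊛ s))) n           ≡⟨ cong (p 0 * (q ⊛ s) n +_) (tail n) ⟩
  p 0 * (q ⊛ s) n + (x^ 1 · (q ⊛ (p ∘ suc ⊛ s))) n           ≡⟨ cong (p 0 * (q ⊛ s) n +_) (⊛-x^1 q (p ∘ suc ⊛ s) n) ⟨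
  p 0 * (q ⊛ s) n + (q ⊛ (x^ 1 · (p ∘ suc ⊛ s))) n           ≡⟨ ⊛-linearʳ q (p 0) s (x^ 1 · (p ∘ suc ⊛ s)) n ⟨
  (q ⊛ (λ m → p 0 * s m + (x^ 1 · (p ∘ suc ⊛ s)) m)) n       ≡⟨ ⊛-congʳ q (⊛-unfold p s) n ⟨
  (q ⊛ (p ⊛ s)) n                                            ∎
  where
  open ≡-Reasoning
  tail : ∀ m → (x^ 1 · (p ∘ suc ⊛ (q ⊛ s))) m ≡ (x^ 1 · (q ⊛ (p ∘ suc ⊛ s))) m
  tail zero    = refl
  tail (suc m) = ⊛-leftComm (p ∘ suc) q s m

-- Coefficients of sums and products of polynomials

coeff-+ : ∀ p q n → coeff (p +ₚ q) n ≡ coeff p n + coeff q n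
coeff-+ []      q       n       = sym (ℤ.+-identityˡ _)
coeff-+ (a ∷ p) []      n       = sym (ℤ.+-identityʳ _)
coeff-+ (a ∷ p) (b ∷ q) zero    = refl
coeff-+ (a ∷ p) (b ∷ q) (suc n) = coeff-+ p q n

coeff-map-* : ∀ a q n → coeff (map (a *_) q) n ≡ a * coeff q n
coeff-map-* a []      n       = sym (ℤ.*-zeroʳ a)
coeff-map-* a (b ∷ q) zero    = refl
coeff-map-* a (b ∷ q) (suc n) = coeff-map-* a q n

coeff-* : ∀ p q n → coeff (p *ₚ q) n ≡ (coeff p ⊛ coeff q) n
coeff-* []      q n = sym (trans (⊛-constant (coeff []) (coeff q) (λ _ → refl) n) (ℤ.*-zeroˡ (coeff q n)))
coeff-* (a ∷ p) q n = begin
  coeff (map (a *_) q +ₚ (0ℤ ∷ (p *ₚ q))) n       ≡⟨ coeff-+ (map (a *_) q) _ n ⟩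
  coeff (map (a *_) q) n + coeff (0ℤ ∷ (p *ₚ q)) n ≡⟨ cong₂ _+_ (coeff-map-* a q n) (tail n) ⟩
  a * coeff q n + (x^ 1 · (coeff p ⊛ coeff q)) n   ≡⟨ ⊛-unfold (coeff (a ∷ p)) (coeff q) n ⟨
  (coeff (a ∷ p) ⊛ coeff q) n                      ∎
  where
  open ≡-Reasoning
  tail : ∀ m → coeff (0ℤ ∷ (p *ₚ q)) m ≡ (x^ 1 · (coeff p ⊛ coeff q)) m
  tail zero    = refl
  tail (suc m) = coeff-* p q m

-- Laplace expansion and row operations

-- F c stands for the minor on the columns c and the last ∣c∣ rows; expand a F
-- is then the Laplace expansion along one more row a, put on top. In this guise
-- "equal rows give determinant 0" is anticommutativity of the operators expand a.
Form : Set
Form = List ℕ → Series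

Row : Set
Row = ℕ → Series

infix 4 _≈_

_≈_ : Form → Form → Set
F ≈ G = ∀ c n → F c n ≡ G c n

0ᶠ : Form
0ᶠ _ _ = 0ℤ

_-ᶠ_ : Form → Form → Form
(F -ᶠ G) c n = F c n - G c n

expand : Row → Form → Form
expand a F []      n = 0ℤ
-- Either column `x` is removed, or it stays in front of the minor; the nested subtractions produce
-- the alternating signs.
expand a F (x ∷ c) n = (a x ⊛ F c) n - expand a (F ∘ (x ∷_)) c n

expand-cong : ∀ a {F G} → F ≈ G → expand a F ≈ expand a G
expand-cong a F≈G []      n = refl
expand-cong a F≈G (x ∷ c) n =
  cong₂ _-_ (⊛-congʳ (a x) (F≈G c) n) (expand-cong a (F≈G ∘ (x ∷_)) c n)

-‿interchange : ∀ x y z w → x - y - (z - w) ≡ (x - z) - (y - w)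
-‿interchange = solve-∀

expand-minus : ∀ a F G → expand a (F -ᶠ G) ≈ expand a F -ᶠ expand a G
expand-minus a F G []      n = refl
expand-minus a F G (x ∷ c) n =
  trans (cong₂ _-_ (⊛-distribˡ-minus (a x) (F c) (G c) n) (expand-minus a (F ∘ (x ∷_)) (G ∘ (x ∷_)) c n))
        (-‿interchange ((a x ⊛ F c) n) _ _ _)

expand-row-minus : ∀ a b F →
                   expand (λ x n → a x n - b x n) F ≈ expand a F -ᶠ expand b F
expand-row-minus a b F []      n = refl
expand-row-minus a b F (x ∷ c) n =
  trans (cong₂ _-_ (⊛-distribʳ-minus (a x) (b x) (F c) n) (expand-row-minus a b (F ∘ (x ∷_)) c n))
        (-‿interchange ((a x ⊛ F c) n) _ _ _)

expand-⊛ : ∀ a p F c n → expand a (λ d → p ⊛ F d) c n ≡ (p ⊛ expand a F c) n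
expand-⊛ a p F []      n = sym (⊛-zeroʳ p n)
expand-⊛ a p F (x ∷ c) n =
  trans (cong₂ _-_ (⊛-leftComm (a x) p (F c) n) (expand-⊛ a p (F ∘ (x ∷_)) c n))
        (sym (⊛-distribˡ-minus p (a x ⊛ F c) _ n))

-- Of the two rows, `a` takes the first column, or `b` does, or neither; the first two cases are
-- exchanged with opposite signs, and the third is the induction hypothesis.
expand-anticomm : ∀ a b F → expand a (expand b F) ≈ 0ᶠ -ᶠ expand b (expand a F)
expand-anticomm a b F []      n = refl
expand-anticomm a b F (x ∷ c) n = begin
  ab - expand a (λ d → expand b F (x ∷ d)) c n         ≡⟨ cong (ab -_) (inner a b) ⟩
  ab - (ba - expand a (expand b (F ∘ (x ∷_))) c n)
    ≡⟨ cong (λ z → ab - (ba - z)) (expand-anticomm a b (F ∘ (x ∷_)) c n) ⟩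
  ab - (ba - (0ℤ - ba′))                               ≡⟨ lemma ab ba ba′ ⟩
  0ℤ - (ba - (ab - ba′))                               ≡⟨ cong (λ z → 0ℤ - (ba - z)) (inner b a) ⟨
  0ℤ - (ba - expand b (λ d → expand a F (x ∷ d)) c n)  ∎
  where
  open ≡-Reasoning
  ab ba ba′ : ℤ
  ab  = (a x ⊛ expand b F c) n
  ba  = (b x ⊛ expand a F c) n
  ba′ = expand b (expand a (F ∘ (x ∷_))) c n
  lemma : ∀ x y z → x - (y - (0ℤ - z)) ≡ 0ℤ - (y - (x - z))
  lemma = solve-∀
  inner : ∀ a b → expand a (λ d → expand b F (x ∷ d)) c n
                ≡ (b x ⊛ expand a F c) n - expand a (expand b (F ∘ (x ∷_))) c n
  inner a b = trans (expand-minus a (λ d → b x ⊛ F d) (expand b (F ∘ (x ∷_))) c n)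
                    (cong (_- expand a (expand b (F ∘ (x ∷_))) c n) (expand-⊛ a (b x) F c n))

i≡-i⇒i≡0 : ∀ i → i ≡ 0ℤ - i → i ≡ 0ℤ
i≡-i⇒i≡0 (ℤ.+ zero)  _  = refl
i≡-i⇒i≡0 (ℤ.+ suc n) ()
i≡-i⇒i≡0 -[1+ n ]  ()

-- Anticommutativity makes the value its own negative, and the integers have no 2-torsion.
expand-alternating : ∀ a F → expand a (expand a F) ≈ 0ᶠ
expand-alternating a F c n = i≡-i⇒i≡0 _ (expand-anticomm a a F c n)

-- Row 0 is the outermost expansion.
expandRows : ℕ → (ℕ → Row) → Form → Form
expandRows zero    a F = F
expandRows (suc k) a F = expandRows k a (expand (a k) F)

-- Row operations work at the bottom row, which the definition peels off, whereas `det` expands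
-- along the top row.
expandRows-suc : ∀ k a F → expandRows (suc k) a F ≡ expand (a 0) (expandRows k (a ∘ suc) F)
expandRows-suc zero    a F = refl
expandRows-suc (suc k) a F = expandRows-suc k a (expand (a (suc k)) F)

expandRows-cong : ∀ k a {F G} → F ≈ G → expandRows k a F ≈ expandRows k a G
expandRows-cong zero    a F≈G = F≈G
expandRows-cong (suc k) a F≈G = expandRows-cong k a (expand-cong (a k) F≈G)

expandRows-minus : ∀ k a F G → expandRows k a (F -ᶠ G) ≈ expandRows k a F -ᶠ expandRows k a G
expandRows-minus zero    a F G c n = refl
expandRows-minus (suc k) a F G c n =
  trans (expandRows-cong k a (expand-minus (a k) F G) c n) (expandRows-minus k a _ _ c n)

expandRows-zero : ∀ k a → expandRows k a 0ᶠ ≈ 0ᶠ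
expandRows-zero k a c n = trans (expandRows-minus k a 0ᶠ 0ᶠ c n) (ℤ.+-inverseʳ (expandRows k a 0ᶠ c n))

-- The extra bottom row is swapped upwards, changing sign each time, until it meets its equal.
expandRows-repeated : ∀ k a {j} → j < k → ∀ F → expandRows k a (expand (a j) F) ≈ 0ᶠ
expandRows-repeated (suc k) a j<1+k F c n with ℕ.m≤n⇒m<n∨m≡n (s≤s⁻¹ j<1+k)
... | inj₂ refl = trans (expandRows-cong k a (expand-alternating (a k) F) c n) (expandRows-zero k a c n)
... | inj₁ j<k  = begin
  expandRows k a (expand (a k) (expand (a _) F)) c n              ≡⟨ expandRows-cong k a (expand-anticomm (a k) (a _) F) c n ⟩
  expandRows k a (0ᶠ -ᶠ expand (a _) (expand (a k) F)) c n        ≡⟨ expandRows-minus k a 0ᶠ _ c n ⟩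
  expandRows k a 0ᶠ c n - expandRows k a (expand (a _) (expand (a k) F)) c n
    ≡⟨ cong₂ _-_ (expandRows-zero k a c n) (expandRows-repeated k a j<k (expand (a k) F) c n) ⟩
  0ℤ                                                              ∎
  where open ≡-Reasoning

-- By linearity in the bottom row, the error term has a repeated row. The rows above stay unchanged,
-- so such subtractions can be carried out successively from the bottom up.
expandRows-subtract : ∀ k a {j} → j < k → ∀ F →
  expandRows (suc k) a F ≈ expandRows k a (expand (λ x n → a k x n - a j x n) F)
expandRows-subtract k a j<k F c n = sym (begin
  expandRows k a (expand (λ x n → a k x n - a _ x n) F) c n   ≡⟨ expandRows-cong k a (expand-row-minus (a k) (a _) F) c n ⟩
  expandRows k a (expand (a k) F -ᶠ expand (a _) F) c n       ≡⟨ expandRows-minus k a _ _ c n ⟩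
  expandRows (suc k) a F c n - expandRows k a (expand (a _) F) c n
    ≡⟨ cong (expandRows (suc k) a F c n -_) (expandRows-repeated k a j<k F c n) ⟩
  expandRows (suc k) a F c n - 0ℤ                             ≡⟨ ℤ.+-identityʳ _ ⟩
  expandRows (suc k) a F c n                                  ∎)
  where open ≡-Reasoning

-- The determinant as an iterated expansion

coeff-sign : ∀ j n → coeff ((-ₚ const 1ℤ) ^ₚ j) n ≡ (-1ℤ ^ j) * 1ₛ n
coeff-sign zero    zero    = refl
coeff-sign zero    (suc n) = refl
coeff-sign (suc j) n       = begin
  coeff ((-ₚ const 1ℤ) *ₚ ((-ₚ const 1ℤ) ^ₚ j)) n ≡⟨ coeff-* (-ₚ const 1ℤ) ((-ₚ const 1ℤ) ^ₚ j) n ⟩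
  (coeff (-ₚ const 1ℤ) ⊛ coeff ((-ₚ const 1ℤ) ^ₚ j)) n ≡⟨ ⊛-constant (coeff (-ₚ const 1ℤ)) _ (λ _ → refl) n ⟩
  -1ℤ * coeff ((-ₚ const 1ℤ) ^ₚ j) n              ≡⟨ cong (-1ℤ *_) (coeff-sign j n) ⟩
  -1ℤ * ((-1ℤ ^ j) * 1ₛ n)                        ≡⟨ ℤ.*-assoc -1ℤ (-1ℤ ^ j) (1ₛ n) ⟨
  (-1ℤ ^ suc j) * 1ₛ n                            ∎
  where open ≡-Reasoning

coeff-sign-* : ∀ j p n → coeff (((-ₚ const 1ℤ) ^ₚ j) *ₚ p) n ≡ (-1ℤ ^ j) * coeff p n
coeff-sign-* j p n = begin
  coeff (((-ₚ const 1ℤ) ^ₚ j) *ₚ p) n            ≡⟨ coeff-* ((-ₚ const 1ℤ) ^ₚ j) p n ⟩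
  (coeff ((-ₚ const 1ℤ) ^ₚ j) ⊛ coeff p) n       ≡⟨ ⊛-cong (coeff-sign j) (λ _ → refl) n ⟩
  ((λ m → (-1ℤ ^ j) * 1ₛ m) ⊛ coeff p) n         ≡⟨ ⊛-constant _ (coeff p) (λ _ → ℤ.*-zeroʳ (-1ℤ ^ j)) n ⟩
  (-1ℤ ^ j) * 1ℤ * coeff p n                     ≡⟨ cong (_* coeff p n) (ℤ.*-identityʳ (-1ℤ ^ j)) ⟩
  (-1ℤ ^ j) * coeff p n                          ∎
  where open ≡-Reasoning

-- `det` has explicit signs where `expand` nests subtractions; `e` accumulates the sign of the
-- columns already passed.
coeff-sum-expand : ∀ k (z : Fin (suc k) → Poly) e a F (c : Fin (suc k) → ℕ) n →
  (∀ j → coeff (z j) n ≡ e * ((-1ℤ ^ toℕ j) * (a (c j) ⊛ F (tabulate (c ∘ punchIn j))) n)) →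
  coeff (sum z) n ≡ e * expand a F (tabulate c) n
coeff-sum-expand zero z e a F c n z≡ = begin
  coeff (z zero +ₚ []) n      ≡⟨ coeff-+ (z zero) [] n ⟩
  coeff (z zero) n + 0ℤ       ≡⟨ cong (_+ 0ℤ) (z≡ zero) ⟩
  e * (1ℤ * (a (c zero) ⊛ F []) n) + 0ℤ ≡⟨ lemma e _ ⟩
  e * ((a (c zero) ⊛ F []) n - 0ℤ)      ∎
  where
  open ≡-Reasoning
  lemma : ∀ e y → e * (1ℤ * y) + 0ℤ ≡ e * (y - 0ℤ)
  lemma = solve-∀
coeff-sum-expand (suc k) z e a F c n z≡ = begin
  coeff (z zero +ₚ sum (z ∘ suc)) n         ≡⟨ coeff-+ (z zero) _ n ⟩
  coeff (z zero) n + coeff (sum (z ∘ suc)) n ≡⟨ cong₂ _+_ (z≡ zero) rest ⟩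
  e * (1ℤ * (a (c zero) ⊛ F (tabulate (c ∘ suc))) n) + e * -1ℤ * expand a F′ (tabulate (c ∘ suc)) n
    ≡⟨ lemma e _ _ ⟩
  e * ((a (c zero) ⊛ F (tabulate (c ∘ suc))) n - expand a F′ (tabulate (c ∘ suc)) n) ∎
  where
  open ≡-Reasoning
  F′ : Form
  F′ = F ∘ (c zero ∷_)
  lemma : ∀ e y w → e * (1ℤ * y) + e * -1ℤ * w ≡ e * (y - w)
  lemma = solve-∀
  sign : ∀ e s y → e * (-1ℤ * s * y) ≡ e * -1ℤ * (s * y)
  sign = solve-∀
  rest : coeff (sum (z ∘ suc)) n ≡ e * -1ℤ * expand a F′ (tabulate (c ∘ suc)) n
  rest = coeff-sum-expand k (z ∘ suc) (e * -1ℤ) a F′ (c ∘ suc) n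
           (λ j → trans (z≡ (suc j)) (sign e (-1ℤ ^ toℕ j) _))

-- The column labels `c` are arbitrary so that the induction applies to minors, whose columns are no
-- longer consecutive.
coeff-det : ∀ k (A : SquareMatrix k) a (c : Fin k → ℕ) →
            (∀ i j n → coeff (A i j) n ≡ a (toℕ i) (c j) n) →
            ∀ n → coeff (det A) n ≡ expandRows k a (λ _ → 1ₛ) (tabulate c) n
coeff-det zero    A a c A≡ zero    = refl
coeff-det zero    A a c A≡ (suc n) = refl
coeff-det (suc k) A a c A≡ n = begin
  coeff (det A) n                   ≡⟨ coeff-sum-expand k term 1ℤ (a 0) (expandRows k (a ∘ suc) (λ _ → 1ₛ)) c n summand ⟩
  1ℤ * expand (a 0) (expandRows k (a ∘ suc) (λ _ → 1ₛ)) (tabulate c) n ≡⟨ ℤ.*-identityˡ _ ⟩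
  expand (a 0) (expandRows k (a ∘ suc) (λ _ → 1ₛ)) (tabulate c) n
    ≡⟨ cong (λ G → G (tabulate c) n) (expandRows-suc k a (λ _ → 1ₛ)) ⟨
  expandRows (suc k) a (λ _ → 1ₛ) (tabulate c) n ∎
  where
  open ≡-Reasoning
  minor : Fin (suc k) → SquareMatrix k
  minor j i i′ = A (suc i) (punchIn j i′)
  term : Fin (suc k) → Poly
  term j = ((-ₚ const 1ℤ) ^ₚ toℕ j) *ₚ (A zero j *ₚ det (minor j))
  summand : ∀ j → coeff (term j) n
          ≡ 1ℤ * ((-1ℤ ^ toℕ j) * (a 0 (c j) ⊛ expandRows k (a ∘ suc) (λ _ → 1ₛ) (tabulate (c ∘ punchIn j))) n)
  summand j = begin
    coeff (((-ₚ const 1ℤ) ^ₚ toℕ j) *ₚ (A zero j *ₚ det (minor j))) n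
      ≡⟨ coeff-sign-* (toℕ j) (A zero j *ₚ det (minor j)) n ⟩
    (-1ℤ ^ toℕ j) * coeff (A zero j *ₚ det (minor j)) n
      ≡⟨ cong ((-1ℤ ^ toℕ j) *_) (coeff-* (A zero j) (det (minor j)) n) ⟩
    (-1ℤ ^ toℕ j) * (coeff (A zero j) ⊛ coeff (det (minor j))) n
      ≡⟨ cong ((-1ℤ ^ toℕ j) *_) (⊛-cong (A≡ zero j)
           (coeff-det k (minor j) (a ∘ suc) (c ∘ punchIn j) (λ i i′ → A≡ (suc i) (punchIn j i′))) n) ⟩
    (-1ℤ ^ toℕ j) * (a 0 (c j) ⊛ expandRows k (a ∘ suc) (λ _ → 1ₛ) (tabulate (c ∘ punchIn j))) n
      ≡⟨ ℤ.*-identityˡ _ ⟨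
    1ℤ * ((-1ℤ ^ toℕ j) * (a 0 (c j) ⊛ expandRows k (a ∘ suc) (λ _ → 1ₛ) (tabulate (c ∘ punchIn j))) n) ∎

-- Degree bounds for expansions

-- Degrees at most `e - d` and `b - w` add up under multiplication. Moving the subtracted terms to
-- the other side avoids truncation, so a negative bound means that the series is 0.
⊛-vanishes : ∀ {p s : Series} e d b w →
             (∀ n → e < n ℕ.+ d → p n ≡ 0ℤ) → (∀ n → b < n ℕ.+ w → s n ≡ 0ℤ) →
             ∀ n → e ℕ.+ b < n ℕ.+ (d ℕ.+ w) → (p ⊛ s) n ≡ 0ℤ
⊛-vanishes {p} {s} e d b w p-vanishes s-vanishes = go
  where
  head : ∀ n → e ℕ.+ b < n ℕ.+ (d ℕ.+ w) → p 0 * s n ≡ 0ℤ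
  head n e+b< with e ℕ.<? d
  ... | yes e<d = trans (cong (_* s n) (p-vanishes 0 e<d)) (ℤ.*-zeroˡ (s n))
  ... | no  e≮d = trans (cong (p 0 *_) (s-vanishes n b<)) (ℤ.*-zeroʳ (p 0))
    where
    swap : ∀ n d w → n ℕ.+ (d ℕ.+ w) ≡ d ℕ.+ (n ℕ.+ w)
    swap = ℕ-solve-∀
    b< : b < n ℕ.+ w
    b< = ℕ.+-cancelˡ-< d b (n ℕ.+ w)
           (ℕ.≤-<-trans (ℕ.+-monoˡ-≤ b (ℕ.≮⇒≥ e≮d)) (subst (e ℕ.+ b <_) (swap n d w) e+b<))
  go : ∀ n → e ℕ.+ b < n ℕ.+ (d ℕ.+ w) → (p ⊛ s) n ≡ 0ℤ
  go zero    e+b< = head zero e+b<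
  go (suc n) e+b< = cong₂ _+_ (head (suc n) e+b<)
    -- Dropping the constant term of `p` lowers its degree bound by one, hence `suc d`.
    (⊛-vanishes e (suc d) b w
      (λ m e< → p-vanishes (suc m) (subst (e <_) (ℕ.+-suc m d) e<)) s-vanishes
      n (subst (e ℕ.+ b <_) (sym (ℕ.+-suc n (d ℕ.+ w))) e+b<))

-- The indicator of even numbers, valued in `ℕ` to serve as the degree bound for entries of a
-- column.
evenness : ℕ → ℕ
evenness 0             = 1
evenness 1             = 0
evenness (suc (suc n)) = evenness n

evens : List ℕ → ℕ
evens []      = 0
evens (x ∷ c) = evenness x ℕ.+ evens c

-- F c has degree at most b + evens c - w, and is 0 if this is negative. The
-- offset b accounts for columns already put in front of c.
Bounded : ℕ → ℕ → Form → Set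
Bounded w b F = ∀ c n → b ℕ.+ evens c < n ℕ.+ w → F c n ≡ 0ℤ

-- For `d = 0`, entries are at most linear in t, and constant in odd columns; for `d = 1`, they are
-- constant, and 0 in odd columns.
RowBounded : ℕ → Row → Set
RowBounded d a = ∀ x n → evenness x < n ℕ.+ d → a x n ≡ 0ℤ

-- Using column `x` for the new row contributes degree at most `evenness x - d`, and the other
-- columns keep their share. If `x` is kept instead, its share moves into the offset `b`.
expand-bounded : ∀ {d w b a F} → RowBounded d a → Bounded w b F → Bounded (d ℕ.+ w) b (expand a F)
expand-bounded aB FB [] n _ = refl
expand-bounded {d} {w} {b} {a} {F} aB FB (x ∷ c) n b+< = cong₂ _-_
  (⊛-vanishes {a x} {F c} (evenness x) d (b ℕ.+ evens c) w (aB x) (FB c) n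
    (subst (_< n ℕ.+ (d ℕ.+ w)) (swap b (evenness x) (evens c)) b+<))
  (expand-bounded {d} {w} {b ℕ.+ evenness x} aB
    (λ c′ n′ lt → FB (x ∷ c′) n′ (subst (_< n′ ℕ.+ w) (ℕ.+-assoc b (evenness x) (evens c′)) lt))
    c n (subst (_< n ℕ.+ (d ℕ.+ w)) (sym (ℕ.+-assoc b (evenness x) (evens c))) b+<))
  where
  swap : ∀ b e c → b ℕ.+ (e ℕ.+ c) ≡ e ℕ.+ (b ℕ.+ c)
  swap = ℕ-solve-∀

expandRows-bounded : ∀ {w a} → (∀ i → RowBounded 0 (a i)) →
                     ∀ k {F} → Bounded w 0 F → Bounded w 0 (expandRows k a F)
expandRows-bounded rowB zero    FB = FB
expandRows-bounded {w} rowB (suc k) FB = expandRows-bounded rowB k (expand-bounded {w = w} (rowB k) FB)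

-- Since `⌈ i /2⌉` is by definition `⌊ suc i /2⌋`, the view records whether the half grows from `i`
-- to `suc i`.
data ParityView (i : ℕ) : Set where
  even : evenness i ≡ 1 → ⌈ i /2⌉ ≡ ⌊ i /2⌋ → ParityView i
  odd  : evenness i ≡ 0 → ⌈ i /2⌉ ≡ suc ⌊ i /2⌋ → ParityView i

parityView : ∀ i → ParityView i
parityView 0 = even refl refl
parityView 1 = odd refl refl
parityView (suc (suc i)) with parityView i
... | even e h = even e (cong suc h)
... | odd e h  = odd e (cong suc h)

-- Rows are treated from the bottom up. Each odd one from row 4 on is replaced by its difference
-- with the row four above, which lowers the degree bound by one; there are `⌊ i /2⌋` of these. The
-- first four rows are left alone.
expandRows-bounded-by-differences : ∀ {a} → (∀ i → RowBounded 0 (a i)) →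
  (∀ i → evenness i ≡ 0 → RowBounded 1 (λ x n → a (4 ℕ.+ i) x n - a i x n)) →
  ∀ i {w F} → Bounded w 0 F → Bounded (⌊ i /2⌋ ℕ.+ w) 0 (expandRows (4 ℕ.+ i) a F)
expandRows-bounded-by-differences rowB diffB zero FB = expandRows-bounded rowB 4 FB
expandRows-bounded-by-differences {a} rowB diffB (suc i) {w} {F} FB with parityView i
... | even _ h = subst (λ h → Bounded (h ℕ.+ w) 0 (expandRows (5 ℕ.+ i) a F)) (sym h)
                   (expandRows-bounded-by-differences rowB diffB i
                     (expand-bounded {w = w} (rowB (4 ℕ.+ i)) FB))
... | odd e h  = λ c n lt →
  trans (expandRows-subtract (4 ℕ.+ i) a (ℕ.m<n+m i (s≤s z≤n)) F c n)
        (expandRows-bounded-by-differences rowB diffB i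
          (expand-bounded {w = w} (diffB i e) FB) c n
          (subst (evens c <_) (cong (n ℕ.+_) (trans (cong (ℕ._+ w) h) (sym (ℕ.+-suc ⌊ i /2⌋ w)))) lt))

-- The paperfolding sequence at even indices

evenness≡0⇒2∣1+ : ∀ n → evenness n ≡ 0 → 2 ∣ suc n
evenness≡0⇒2∣1+ 1             _ = ∣-refl
evenness≡0⇒2∣1+ (suc (suc n)) e = ∣m∣n⇒∣m+n (∣-refl {2}) (evenness≡0⇒2∣1+ n e)

2∤1 : ¬ 2 ∣ 1
2∤1 = >⇒∤ (s≤s (s≤s z≤n))

evenness≡0⇒2∤ : ∀ n → evenness n ≡ 0 → ¬ 2 ∣ n
evenness≡0⇒2∤ n e 2∣n = 2∤1 (∣m+n∣m⇒∣n (subst (2 ∣_) (ℕ.+-comm 1 n) (evenness≡0⇒2∣1+ n e)) 2∣n)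

odd+odd : ∀ i x → evenness i ≡ 0 → evenness x ≡ 0 → 2 ∣ i ℕ.+ x
odd+odd i x ei ex = ∣m+n∣m⇒∣n {n = i ℕ.+ x} (subst (2 ∣_) (lemma i x)
                      (∣m∣n⇒∣m+n (evenness≡0⇒2∣1+ i ei) (evenness≡0⇒2∣1+ x ex))) ∣-refl
  where
  lemma : ∀ i x → suc i ℕ.+ suc x ≡ 2 ℕ.+ (i ℕ.+ x)
  lemma = ℕ-solve-∀

-- Every exponent in this term is `2 ^ suc n - 1` plus a multiple of `2 ^ (suc n + 2)`, hence odd.
paperfoldingTerm-even : ∀ n {m} → 2 ∣ m → paperfoldingTerm (suc n) m ≡ 0ℤ
paperfoldingTerm-even n {m} 2∣m with 2 ℕ.^ suc n ℕ.∸ 1 ℕ.≤? m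
... | no  a≰m = shift-< _ _ m (ℕ.≰⇒> a≰m)
... | yes a≤m = trans (shift-≥ _ _ m a≤m) (geometric-∤ λ d∣m∸a →
        2∤1 (∣m+n∣m⇒∣n {n = 1} (subst (2 ∣_) (sym (ℕ.m∸n+n≡m (ℕ.m^n>0 2 (suc n)))) (m∣m*n (2 ℕ.^ n)))
          (∣m+n∣m⇒∣n (subst (2 ∣_) (sym (ℕ.m∸n+n≡m a≤m)) 2∣m)
            (∣-trans (m∣m*n (2 ℕ.^ (n ℕ.+ 2))) d∣m∸a))))

paperfolding-even : ∀ {m} → 2 ∣ m → paperfolding m ≡ 1/[1-x^ 4 ] m
paperfolding-even {m} 2∣m = partialSums m
  where
  partialSums : ∀ N → partialSum paperfoldingTerm (suc N) m ≡ 1/[1-x^ 4 ] m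
  partialSums zero    = ℤ.+-identityˡ _
  partialSums (suc N) = trans (cong₂ _+_ (partialSums N) (paperfoldingTerm-even N 2∣m)) (ℤ.+-identityʳ _)

paperfolding-4+ : ∀ {m} → 2 ∣ m → paperfolding (4 ℕ.+ m) ≡ paperfolding m
paperfolding-4+ {m} 2∣m = begin
  paperfolding (4 ℕ.+ m)   ≡⟨ paperfolding-even (∣m∣n⇒∣m+n (divides 2 refl) 2∣m) ⟩
  -- At index `4 + m` the shifted series reduces to its value at `m`, and `1ₛ` to 0.
  1/[1-x^ 4 ] (4 ℕ.+ m)    ≡⟨ ℤ.i-j≡0⇒i≡j _ _ (geometric-inverse 4 (4 ℕ.+ m)) ⟩
  1/[1-x^ 4 ] m            ≡⟨ paperfolding-even 2∣m ⟨
  paperfolding m           ∎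
  where open ≡-Reasoning

paperfolding-2*odd : ∀ x → evenness x ≡ 0 → paperfolding (2 ℕ.* x) ≡ 0ℤ
paperfolding-2*odd x e = trans (paperfolding-even (m∣m*n x))
  (geometric-∤ (λ 4∣2x → evenness≡0⇒2∤ x e (*-cancelˡ-∣ 2 4∣2x)))

-- Rows of the t-Hankel matrix

-- Taking the decision as an argument lets proofs match on it and lets indices be compared as
-- natural numbers instead of elements of `Fin k`.
tHankelEntry : (ℕ → ℤ) → ∀ i x → Dec (i ≡ x) → Poly
tHankelEntry c i x (yes _) = const (c (2 ℕ.* i)) *ₚ t
tHankelEntry c i x (no _)  = const (c (i ℕ.+ x))

tHankelMatrix-entry : ∀ c {k} (i j : Fin k) d →
                      tHankelMatrix c k i j ≡ tHankelEntry c (toℕ i) (toℕ j) d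
tHankelMatrix-entry c i j d with i Fin.≟ j
tHankelMatrix-entry c i j (yes _)   | yes _   = refl
tHankelMatrix-entry c i j (no _)    | no _    = refl
tHankelMatrix-entry c i j (no i≢j)  | yes i≡j = contradiction (cong toℕ i≡j) i≢j
tHankelMatrix-entry c i j (yes i≡j) | no i≢j  = contradiction (Fin.toℕ-injective i≡j) i≢j

-- Only the diagonal carries t, and in an odd column its coefficient `c (2 * i)` is 0.
tHankelEntry-bounded : ∀ c → (∀ i → evenness i ≡ 0 → c (2 ℕ.* i) ≡ 0ℤ) →
                       ∀ i x d n → evenness x < n → coeff (tHankelEntry c i x d) n ≡ 0ℤ
tHankelEntry-bounded c c≡0 i x (no _)     (suc n)       _  = refl
tHankelEntry-bounded c c≡0 i x (yes refl) (suc zero)    lt =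
  cong (_* 1ℤ) (c≡0 i (ℕ.n<1⇒n≡0 lt))
tHankelEntry-bounded c c≡0 i x (yes refl) (suc (suc n)) _  = refl

-- A zero diagonal entry is unaffected by the factor t, so the row is that of the ordinary Hankel
-- matrix.
tHankelEntry-constant : ∀ c {i} → c (2 ℕ.* i) ≡ 0ℤ → ∀ x d n →
                        coeff (tHankelEntry c i x d) n ≡ coeff (const (c (i ℕ.+ x))) n
tHankelEntry-constant c c≡0 x (no _) n = refl
tHankelEntry-constant c {i} c≡0 x (yes refl) n = begin
  coeff (const (c (2 ℕ.* i)) *ₚ t) n ≡⟨ cong (λ a → coeff (const a *ₚ t) n) c≡0 ⟩
  coeff (const 0ℤ *ₚ t) n            ≡⟨ zeros n ⟩
  coeff (const 0ℤ) n                 ≡⟨ cong (λ a → coeff (const a) n) c≡0 ⟨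
  coeff (const (c (2 ℕ.* i))) n      ≡⟨ cong (λ m → coeff (const (c (i ℕ.+ m))) n) (ℕ.+-identityʳ i) ⟩
  coeff (const (c (i ℕ.+ i))) n      ∎
  where
  open ≡-Reasoning
  zeros : ∀ n → coeff (const 0ℤ *ₚ t) n ≡ coeff (const 0ℤ) n
  zeros 0             = refl
  zeros 1             = refl
  zeros (suc (suc n)) = refl

paperfoldingRow : ℕ → Row
paperfoldingRow i x = coeff (tHankelEntry paperfolding i x (i ℕ.≟ x))

paperfoldingRow-bounded : ∀ i → RowBounded 0 (paperfoldingRow i)
paperfoldingRow-bounded i x n lt =
  tHankelEntry-bounded paperfolding paperfolding-2*odd i x (i ℕ.≟ x) n
    (subst (evenness x <_) (ℕ.+-identityʳ n) lt)

paperfoldingRow-odd : ∀ i → evenness i ≡ 0 → ∀ x n →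
                      paperfoldingRow i x n ≡ coeff (const (paperfolding (i ℕ.+ x))) n
paperfoldingRow-odd i e x = tHankelEntry-constant paperfolding (paperfolding-2*odd i e) x (i ℕ.≟ x)

-- Both rows are free of t. In an odd column `x` the index `i + x` is even, where the sequence has
-- period 4.
paperfoldingRow-difference : ∀ i → evenness i ≡ 0 →
  RowBounded 1 (λ x n → paperfoldingRow (4 ℕ.+ i) x n - paperfoldingRow i x n)
paperfoldingRow-difference i e x n lt =
  trans (cong₂ _-_ (paperfoldingRow-odd (4 ℕ.+ i) e x n) (paperfoldingRow-odd i e x n)) (constants n lt)
  where
  constants : ∀ n → evenness x < n ℕ.+ 1 →
              coeff (const (paperfolding (4 ℕ.+ i ℕ.+ x))) n - coeff (const (paperfolding (i ℕ.+ x))) n ≡ 0ℤ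
  constants zero    lt = ℤ.i≡j⇒i-j≡0 (paperfolding-4+ (odd+odd i x e (ℕ.n<1⇒n≡0 lt)))
  constants (suc n) lt = refl

-- Counting even columns and the final bound

evens-shift : ∀ k (c : Fin k → ℕ) → evens (tabulate (λ j → suc (suc (c j)))) ≡ evens (tabulate c)
evens-shift zero    c = refl
evens-shift (suc k) c = cong (evenness (c zero) ℕ.+_) (evens-shift k (c ∘ suc))

evens-toℕ : ∀ k → evens (tabulate (toℕ {k})) ≡ ⌈ k /2⌉
evens-toℕ 0             = refl
evens-toℕ 1             = refl
evens-toℕ (suc (suc k)) = cong suc (trans (evens-shift k toℕ) (evens-toℕ k))

⌈n/2⌉≤1+⌊n/2⌋ : ∀ n → ⌈ n /2⌉ ≤ suc ⌊ n /2⌋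
-- By definition the two sides are the floors of half of `1 + n` and of half of `2 + n`.
⌈n/2⌉≤1+⌊n/2⌋ n = ℕ.⌊n/2⌋-mono (ℕ.n≤1+n (suc n))

1ₛ-bounded : Bounded 0 0 (λ _ → 1ₛ)
1ₛ-bounded c (suc n) _ = refl

tHankel-coeff : ∀ k n → coeff (tHankel k paperfolding) n
                      ≡ expandRows k paperfoldingRow (λ _ → 1ₛ) (tabulate (toℕ {k})) n
tHankel-coeff k = coeff-det k (tHankelMatrix paperfolding k) paperfoldingRow toℕ
  λ i j n → cong (λ p → coeff p n) (tHankelMatrix-entry paperfolding i j (toℕ i ℕ.≟ toℕ j))

-- Each even column contributes at most one factor t. This settles `k` below 4, where no row has
-- another four above it.
tHankel-smallDegree : ∀ k → Degree≤ ⌈ k /2⌉ (tHankel k paperfolding)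
tHankel-smallDegree k n lt = trans (tHankel-coeff k n)
  (expandRows-bounded paperfoldingRow-bounded k 1ₛ-bounded (tabulate (toℕ {k})) n
    (subst₂ _<_ (sym (evens-toℕ k)) (sym (ℕ.+-identityʳ n)) lt))

theorem1p4 : ∀ (k : ℕ) .{{_ : NonZero k}} → Degree≤ 3 (tHankel k paperfolding)
theorem1p4 1 n 3<n = tHankel-smallDegree 1 n (ℕ.≤-<-trans (s≤s z≤n) 3<n)
theorem1p4 2 n 3<n = tHankel-smallDegree 2 n (ℕ.≤-<-trans (s≤s z≤n) 3<n)
theorem1p4 3 n 3<n = tHankel-smallDegree 3 n (ℕ.≤-<-trans (s≤s (s≤s z≤n)) 3<n)
theorem1p4 (suc (suc (suc (suc i)))) n 3<n = trans (tHankel-coeff (4 ℕ.+ i) n)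
  (expandRows-bounded-by-differences paperfoldingRow-bounded paperfoldingRow-difference i 1ₛ-bounded
    (tabulate (toℕ {4 ℕ.+ i})) n (begin-strict
      evens (tabulate (toℕ {4 ℕ.+ i})) ≡⟨ evens-toℕ (4 ℕ.+ i) ⟩
      2 ℕ.+ ⌈ i /2⌉                    ≤⟨ ℕ.+-monoʳ-≤ 2 (⌈n/2⌉≤1+⌊n/2⌋ i) ⟩
      3 ℕ.+ ⌊ i /2⌋                    <⟨ ℕ.+-monoˡ-< ⌊ i /2⌋ 3<n ⟩
      n ℕ.+ ⌊ i /2⌋                    ≡⟨ cong (n ℕ.+_) (ℕ.+-identityʳ ⌊ i /2⌋) ⟨
      n ℕ.+ (⌊ i /2⌋ ℕ.+ 0)            ∎))
  where open ℕ.≤-Reasoning
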